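{- For every positive integer $n$ there exists a bijection $\phi:\mathcal{H}_n\to\mathcal{H}_n$ such that $\mathrm{rep}(\lambda)=\mathrm{even}(\phi(\lambda))$ for every $\lambda\in\mathcal{H}_n$.
   Context: A partition is a finite nonempty weakly decreasing sequence $\lambda=(\lambda_1,\ldots,\lambda_k)$ of positive integers; $\ell(\lambda)=k$. The perimeter is $\Gamma(\lambda)=\lambda_1+\ell(\lambda)-1$; $\mathcal{H}_n$ is the set of partitions with perimeter $n$. $\mathrm{rep}(\lambda)=|\{1\le i\le \ell(\lambda)-1:\lambda_i=\lambda_{i+1}\}|$ and $\mathrm{even}(\lambda)=|\{1\le i\le\ell(\lambda):\lambda_i\text{ even}\}|$. -}

module Defs where

open import Data.List.Base using (List; length; filter; zip)
open import Data.List.NonEmpty.Base using (List⁺; toList; head; tail)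
open import Data.List.Relation.Unary.All as All using (All)
open import Data.List.Relation.Unary.Linked as Linked using (Linked)
open import Data.Nat.Base using (ℕ; _+_; _∸_; _<_; _≥_)
open import Data.Nat.Divisibility using (_∣?_)
open import Data.Nat.Properties using (_≟_; ≡-irrelevant; ≤-irrelevant; <-irrelevant)
open import Data.Product.Base using (Σ; _×_; _,_; proj₁; uncurry)
open import Relation.Binary.PropositionalEquality.Core using (_≡_; refl; cong)

record Partition : Set where
  constructor mkPartition
  field
    parts      : List⁺ ℕ
    positive   : All (0 <_) (toList parts)
    decreasing : Linked _≥_ (toList parts)

open Partition public

partList : Partition → List ℕ
partList p = toList (parts p)

ℓ : Partition → ℕ
ℓ p = length (partList p)

-- The truncated subtraction is exact because ℓ p ≥ 1.
Γ : Partition → ℕ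
Γ p = (head (parts p) + ℓ p) ∸ 1

ℋ : ℕ → Set
ℋ n = Σ Partition λ p → Γ p ≡ n

-- [(λ₁ , λ₂) , (λ₂ , λ₃) , … , (λₖ₋₁ , λₖ)]; zip stops at the shorter list.
consecutive : Partition → List (ℕ × ℕ)
consecutive p = zip (partList p) (tail (parts p))

rep : Partition → ℕ
rep p = length (filter (uncurry _≟_) (consecutive p))

even : Partition → ℕ
even p = length (filter (2 ∣?_) (partList p))

-- The proof components are propositions, so propositional equality on
-- Partition and on ℋ n is equality of the underlying sequences.

Partition-≡ : ∀ {p q} → parts p ≡ parts q → p ≡ q
Partition-≡ {mkPartition xs a b} {mkPartition .xs c d} refl
  with refl ← All.irrelevant <-irrelevant a c
     | refl ← Linked.irrelevant ≤-irrelevant b d = refl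

ℋ-≡ : ∀ {n} {x y : ℋ n} → parts (proj₁ x) ≡ parts (proj₁ y) → x ≡ y
ℋ-≡ {x = p , e} {y = q , f} eq with refl ← Partition-≡ {p} {q} eq =
  cong (p ,_) (≡-irrelevant e f)

{-# OPTIONS --safe #-}

-- Every partition arises uniquely from (1) by increasing or duplicating its largest
-- part, each step adding 1 to the perimeter; so ℋ (1 + m) is the set of words of
-- length m in the letters true (increase) and false (duplicate).  Record after each
-- step one bit: for rep, whether the step was an increase; for even, whether the
-- largest part is odd.  With these states the two statistics are computed by the same
-- weighted automaton, so φ sends a word to the word with the same sequence of states:
-- the largest part has to be increased exactly when the state changes.
module Submission where

open import Defs
open import Data.Bool.Base using (Bool; true; false; not; _xor_; if_then_else_)
open import Data.Bool.Properties using (xor-assoc; xor-same; xor-identityʳ)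
open import Data.List.Base using (List; []; _∷_; length; filter; zip; drop)
open import Data.List.NonEmpty.Base using (_∷_; head; tail)
open import Data.List.Relation.Unary.All using ([]; _∷_)
open import Data.List.Relation.Unary.Linked using (Linked; [-]; _∷_)
open import Data.Nat.Base using (ℕ; zero; suc; _+_; _∸_; _<_; _≥_; z≤n; s≤s)
open import Data.Nat.Divisibility using (_∣?_)
open import Data.Nat.Properties using (_≟_; +-suc; suc-injective; m≤n⇒m≤1+n; ≤-refl; ≤-trans; ≤-pred; ≤∧≢⇒<; <⇒≢; 1+n≰n)
open import Data.Product.Base using (Σ; ∃; ∃₂; _×_; _,_; proj₁; uncurry)
open import Data.Vec.Base using (Vec; []; _∷_)
open import Function.Bundles using (_⤖_; _↔_; module Bijection; module Inverse; mk⤖; mk↔ₛ′)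
open import Function.Construct.Composition using (_↔-∘_)
open import Function.Construct.Symmetry using (↔-sym)
open import Function.Properties.Bijection using (⤖⇒↔)
open import Function.Properties.Inverse using (↔⇒⤖)
open import Relation.Binary.PropositionalEquality using (_≡_; refl; sym; trans; cong; cong₂; ≢-sym)
open import Relation.Nullary.Decidable using (does; yes; no; dec-true; dec-false)
open import Relation.Nullary.Negation using (contradiction)
open import Relation.Unary using (Pred; Decidable)

Γ≡head+length : ∀ p → Γ p ≡ head (parts p) + length (tail (parts p))
Γ≡head+length p = cong (_∸ 1) (+-suc (head (parts p)) (length (tail (parts p))))

raise-head : ∀ {h t} → Linked _≥_ (h ∷ t) → Linked _≥_ (suc h ∷ t)
raise-head [-]      = [-]
raise-head (r ∷ rs) = m≤n⇒m≤1+n r ∷ rs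

increase : Partition → Partition
increase (mkPartition (h ∷ t) (_ ∷ ps) d) = mkPartition (suc h ∷ t) (s≤s z≤n ∷ ps) (raise-head d)

duplicate : Partition → Partition
duplicate (mkPartition (h ∷ t) (p ∷ ps) d) = mkPartition (h ∷ h ∷ t) (p ∷ p ∷ ps) (≤-refl ∷ d)

step : Bool → Partition → Partition
step true  = increase
step false = duplicate

Γ-step : ∀ b p → Γ (step b p) ≡ suc (Γ p)
Γ-step true  p@(mkPartition (h ∷ t) (_ ∷ _) _) =
  trans (Γ≡head+length (increase p)) (cong suc (sym (Γ≡head+length p)))
Γ-step false p@(mkPartition (h ∷ t) (_ ∷ _) _) =
  trans (Γ≡head+length (duplicate p)) (trans (+-suc h (length t)) (cong suc (sym (Γ≡head+length p))))

-- The last step is visible in the result: after an increase the largest part strictly exceeds the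
-- next one, after a duplication the two agree.
step-injective : ∀ b c p q → parts (step b p) ≡ parts (step c q) → b ≡ c × p ≡ q
step-injective true  true  (mkPartition _ (_ ∷ _) _) (mkPartition _ (_ ∷ _) _) refl = refl , Partition-≡ refl
step-injective false false (mkPartition _ (_ ∷ _) _) (mkPartition _ (_ ∷ _) _) refl = refl , Partition-≡ refl
-- Before its increase, `p` would begin with some `h` followed by `suc h`, against weak decrease.
step-injective true  false (mkPartition _ (_ ∷ _) (r ∷ _)) (mkPartition _ (_ ∷ _) _) refl = contradiction r 1+n≰n
step-injective false true  (mkPartition _ (_ ∷ _) _) (mkPartition _ (_ ∷ _) (r ∷ _)) refl = contradiction r 1+n≰n

-- If the two largest parts agree, drop one copy; otherwise lower the largest part by 1. Only (1)
-- admits neither, and its perimeter is 1.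
step-surjective : ∀ {m} p → Γ p ≡ suc (suc m) → ∃₂ λ b q → step b q ≡ p
step-surjective (mkPartition (suc zero ∷ []) _ _) ()
step-surjective (mkPartition (suc (suc h) ∷ []) _ _) _ =
  true , mkPartition (suc h ∷ []) (s≤s z≤n ∷ []) [-] , Partition-≡ refl
step-surjective (mkPartition (h ∷ x ∷ t) (_ ∷ q ∷ ps) (r ∷ rs)) _ with x ≟ h
... | yes refl = false , mkPartition (x ∷ t) (q ∷ ps) rs , Partition-≡ refl
step-surjective (mkPartition (suc h ∷ x ∷ t) (_ ∷ q ∷ ps) (r ∷ rs)) _ | no x≢h
  = true , mkPartition (h ∷ x ∷ t) (≤-trans q x≤h ∷ q ∷ ps) (x≤h ∷ rs) , Partition-≡ refl
  where x≤h = ≤-pred (≤∧≢⇒< r x≢h)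

one : Partition
one = mkPartition (1 ∷ []) (s≤s z≤n ∷ []) [-]

build : ∀ {m} → Vec Bool m → Partition
build []      = one
build (b ∷ w) = step b (build w)

Γ-build : ∀ {m} (w : Vec Bool m) → Γ (build w) ≡ suc m
Γ-build []      = refl
Γ-build (b ∷ w) = trans (Γ-step b (build w)) (cong suc (Γ-build w))

build-injective : ∀ {m} (v w : Vec Bool m) → build v ≡ build w → v ≡ w
build-injective []      []      _  = refl
build-injective (b ∷ v) (c ∷ w) eq with step-injective b c (build v) (build w) (cong parts eq)
... | refl , eq′ = cong (b ∷_) (build-injective v w eq′)

build-surjective : ∀ m p → Γ p ≡ suc m → ∃ λ (w : Vec Bool m) → build w ≡ p
build-surjective zero (mkPartition (suc zero ∷ []) _ _) _ = [] , Partition-≡ refl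
build-surjective zero (mkPartition (zero ∷ _) (() ∷ _) _) _
build-surjective zero p@(mkPartition (suc h ∷ _ ∷ t) _ _) eq
  with () ← trans (sym (+-suc h (length t))) (suc-injective (trans (sym (Γ≡head+length p)) eq))
build-surjective zero p@(mkPartition (suc (suc h) ∷ []) _ _) eq
  with () ← trans (sym (Γ≡head+length p)) eq
build-surjective (suc m) p eq with step-surjective p eq
... | b , q , refl with build-surjective m q (suc-injective (trans (sym (Γ-step b q)) eq))
...   | w , refl = b ∷ w , refl

words⤖ℋ : ∀ m → Vec Bool m ⤖ ℋ (suc m)
words⤖ℋ m = mk⤖ {to = λ w → build w , Γ-build w}
  ( (λ {v} {w} eq → build-injective v w (cong proj₁ eq))
  , λ (p , eq) → let w , e = build-surjective m p eq in w , λ { refl → ℋ-≡ (cong parts e) } )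

-- The state of the empty word is that of the partition (1), whose largest part is
-- odd and not repeated.
state : ∀ {m} → Vec Bool m → Bool
state []      = true
state (b ∷ _) = b

changes : ∀ {m} → Vec Bool m → Vec Bool m
changes []      = []
changes (b ∷ w) = (b xor state w) ∷ changes w

-- Recovers the states as running xors of the letters, from the initial state `true`; hence the
-- state is taken from the output already built, not from `w`.
unchanges : ∀ {m} → Vec Bool m → Vec Bool m
unchanges []      = []
unchanges (b ∷ w) = (b xor state (unchanges w)) ∷ unchanges w

xor-cancelʳ : ∀ b c → (b xor c) xor c ≡ b
xor-cancelʳ b c = trans (xor-assoc b c c) (trans (cong (b xor_) (xor-same c)) (xor-identityʳ b))

changes∘unchanges : ∀ {m} (w : Vec Bool m) → changes (unchanges w) ≡ w
changes∘unchanges []      = refl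
changes∘unchanges (b ∷ w) = cong₂ _∷_ (xor-cancelʳ b _) (changes∘unchanges w)

unchanges∘changes : ∀ {m} (w : Vec Bool m) → unchanges (changes w) ≡ w
unchanges∘changes []      = refl
unchanges∘changes (b ∷ w) rewrite unchanges∘changes w = cong (_∷ w) (xor-cancelʳ b (state w))

changes-↔ : ∀ m → Vec Bool m ↔ Vec Bool m
changes-↔ m = mk↔ₛ′ changes unchanges changes∘unchanges unchanges∘changes

bit : Bool → ℕ
bit b = if b then 1 else 0

length-filter-∷ : ∀ {a p} {A : Set a} {P : Pred A p} (P? : Decidable P) x xs →
  length (filter P? (x ∷ xs)) ≡ bit (does (P? x)) + length (filter P? xs)
length-filter-∷ P? x xs with does (P? x)
... | true  = refl
... | false = refl

reps : List ℕ → ℕ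
reps xs = length (filter (uncurry _≟_) (zip xs (drop 1 xs)))

evens : List ℕ → ℕ
evens xs = length (filter (2 ∣?_) xs)

-- Later steps alter only the largest part or put a copy on top, so what `rest` contributes to
-- either statistic is settled.
rest : Partition → List ℕ
rest p = tail (parts p)

rest-increase : ∀ p → rest (increase p) ≡ rest p
rest-increase (mkPartition _ (_ ∷ _) _) = refl

rest-duplicate : ∀ p → rest (duplicate p) ≡ partList p
rest-duplicate (mkPartition _ (_ ∷ _) _) = refl

rep-step : ∀ b p → rep (step b p) ≡ bit (not b) + reps (rest (step b p))
rep-step true  (mkPartition (h ∷ []) (_ ∷ _) _) = refl
rep-step true  (mkPartition (h ∷ x ∷ t) (_ ∷ _) (r ∷ _)) =
  trans (length-filter-∷ (uncurry _≟_) (suc h , x) (zip (x ∷ t) t))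
        (cong (λ b → bit b + reps (x ∷ t)) (dec-false (suc h ≟ x) (≢-sym (<⇒≢ (s≤s r)))))
rep-step false (mkPartition (h ∷ t) (_ ∷ _) _) =
  trans (length-filter-∷ (uncurry _≟_) (h , h) (zip (h ∷ t) t))
        (cong (λ b → bit b + reps (h ∷ t)) (dec-true (h ≟ h) refl))

rep-build : ∀ {m} (w : Vec Bool m) → rep (build w) ≡ bit (not (state w)) + reps (rest (build w))
rep-build []      = refl
rep-build (b ∷ w) = rep-step b (build w)

2∣?-suc : ∀ n → does (2 ∣? suc n) ≡ not (does (2 ∣? n))
2∣?-suc zero          = refl
2∣?-suc (suc zero)    = refl
-- The remainder modulo 2 computes by stripping two successors, so both sides reduce to those for
-- `n`.
2∣?-suc (suc (suc n)) = 2∣?-suc n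

largestEven : Partition → Bool
largestEven p = does (2 ∣? head (parts p))

largestEven-step : ∀ b p → largestEven (step b p) ≡ b xor largestEven p
largestEven-step true  (mkPartition (h ∷ _) (_ ∷ _) _) = 2∣?-suc h
largestEven-step false (mkPartition _       (_ ∷ _) _) = refl

-- An increase flips the parity of the largest part and a duplication keeps it, while `changes w`
-- increases exactly when the state flips.
largestEven-changes : ∀ {m} (w : Vec Bool m) → largestEven (build (changes w)) ≡ not (state w)
largestEven-changes []      = refl
largestEven-changes (b ∷ w)
  rewrite largestEven-step (b xor state w) (build (changes w)) | largestEven-changes w
  with b | state w
... | true  | true  = refl
... | true  | false = refl
... | false | true  = refl
... | false | false = refl

even-changes : ∀ {m} (w : Vec Bool m) →
  even (build (changes w)) ≡ bit (not (state w)) + evens (rest (build (changes w)))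
even-changes w =
  trans (length-filter-∷ (2 ∣?_) (head (parts p)) (rest p))
        (cong (λ b → bit b + evens (rest p)) (largestEven-changes w))
  where p = build (changes w)

-- Proved together with `rep≡even-changes`, by induction on `w`. In each step both settled counts
-- grow by one exactly when the state is `false` before and after, and otherwise stay fixed.
reps-rest≡evens-rest : ∀ {m} (w : Vec Bool m) →
  reps (rest (build w)) ≡ evens (rest (build (changes w)))

rep≡even-changes : ∀ {m} (w : Vec Bool m) → rep (build w) ≡ even (build (changes w))
rep≡even-changes w =
  trans (rep-build w)
        (trans (cong (bit (not (state w)) +_) (reps-rest≡evens-rest w)) (sym (even-changes w)))

reps-rest≡evens-rest []      = refl
reps-rest≡evens-rest (b ∷ w)
  with b | state w | rep-build w | even-changes w | reps-rest≡evens-rest w | rep≡even-changes w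
-- The right side duplicates, so its old largest part becomes settled; that part is odd and adds
-- nothing.
... | true  | true  | _ | e | ih | _
  rewrite rest-increase (build w) | rest-duplicate (build (changes w)) = trans ih (sym e)
... | true  | false | _ | _ | ih | _
  rewrite rest-increase (build w) | rest-increase (build (changes w)) = ih
-- The left side duplicates, so its old first pair becomes settled; state `true` means that this
-- pair, if present, is strict.
... | false | true  | r | _ | ih | _
  rewrite rest-duplicate (build w) | rest-increase (build (changes w)) = trans r ih
-- Both sides duplicate and settle everything, so the full statistics of the shorter word are
-- compared.
... | false | false | _ | _ | _  | ih
  rewrite rest-duplicate (build w) | rest-duplicate (build (changes w)) = ih

theorem2p7 : (n : ℕ) → 0 < n →
    Σ (ℋ n ⤖ ℋ n) λ φ →
    (p : ℋ n) → rep (proj₁ p) ≡ even (proj₁ (Bijection.to φ p))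
theorem2p7 zero    ()
theorem2p7 (suc m) _ = ↔⇒⤖ (words ↔-∘ (changes-↔ m ↔-∘ ↔-sym words)) , λ p →
    trans (cong (λ q → rep (proj₁ q)) (sym (Inverse.strictlyInverseˡ words p)))
          (rep≡even-changes (Inverse.from words p))
  where words = ⤖⇒↔ (words⤖ℋ m)
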